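{- Let $n\ge 5$ and $2\le k<n$. If $k$ divides $n$, then $\rho(\mathrm{PX}(n,k))=\lceil n/k\rceil+1=n/k+1$.
   Context: For integers $n\ge 3$ and $1\le k<n$, the Praeger–Xu graph $\mathrm{PX}(n,k)$ is the simple graph with vertex set $\mathbb Z_n\times\mathbb Z_2^k$; a vertex is written $(i,x)$ with $x=x_0x_1\cdots x_{k-1}$ a bitstring of length $k$. Two vertices $(i,x)$ and $(j,y)$ are adjacent if and only if (after possibly swapping the two vertices) $j=i+1$ in $\mathbb Z_n$ and $x=az_1\cdots z_{k-1}$, $y=z_1\cdots z_{k-1}b$ for some bits $a,b,z_1,\dots,z_{k-1}\in\mathbb Z_2$. For $n\ge5$, $k\ge 2$ the graph $\mathrm{PX}(n,k)$ admits a 2-coloring of its vertices preserved (class-wise) only by the identity automorphism; $\rho(G)$ denotes the minimum size of a color class over all such 2-colorings of $G$. -}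

module Defs where

open import Data.Nat using (ℕ; zero; suc; _≤_)
open import Data.Nat.DivMod using (_mod_)
open import Data.Fin using (Fin; toℕ)
open import Data.Bool using (Bool; true; false; _≟_)
open import Data.Vec using (Vec; []; _∷_; _∷ʳ_)
open import Data.List using (List; []; _∷_; map; concatMap; filter; length; allFin)
open import Data.Product using (Σ; _×_; _,_; ∃)
open import Data.Sum using (_⊎_)
open import Data.Unit using (⊤)
open import Relation.Binary.PropositionalEquality using (_≡_)

next : ∀ {n} → Fin n → Fin n
next {suc m} i = suc (toℕ i) mod suc m

Vertex : ℕ → ℕ → Set
Vertex n k = Fin n × Vec Bool k

Shift : ∀ {k} → Vec Bool k → Vec Bool k → Set
Shift {zero} x y = ⊤
Shift {suc m} x y =
  Σ Bool λ a → Σ Bool λ b → Σ (Vec Bool m) λ z → (x ≡ a ∷ z) × (y ≡ z ∷ʳ b)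

Adj : ∀ n k → Vertex n k → Vertex n k → Set
Adj n k (i , x) (j , y) = (j ≡ next i × Shift x y) ⊎ (i ≡ next j × Shift y x)

record Automorphism (n k : ℕ) : Set where
  field
    σ     : Vertex n k → Vertex n k
    σ⁻¹   : Vertex n k → Vertex n k
    left  : ∀ v → σ⁻¹ (σ v) ≡ v
    right : ∀ v → σ (σ⁻¹ v) ≡ v
    adj⇒  : ∀ u v → Adj n k u v → Adj n k (σ u) (σ v)
    adj⇐  : ∀ u v → Adj n k (σ u) (σ v) → Adj n k u v

Distinguishing : ∀ n k → (Vertex n k → Bool) → Set
Distinguishing n k c =
  (φ : Automorphism n k) → (∀ v → c (Automorphism.σ φ v) ≡ c v) →
  ∀ v → Automorphism.σ φ v ≡ v

allVecs : (k : ℕ) → List (Vec Bool k)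
allVecs zero = [] ∷ []
allVecs (suc k) = concatMap (λ v → (false ∷ v) ∷ (true ∷ v) ∷ []) (allVecs k)

allVertices : ∀ n k → List (Vertex n k)
allVertices n k = concatMap (λ i → map (λ x → (i , x)) (allVecs k)) (allFin n)

classSize : ∀ n k → (Vertex n k → Bool) → Bool → ℕ
classSize n k c b = length (filter (λ v → c v ≟ b) (allVertices n k))

IsRho : ℕ → ℕ → ℕ → Set
IsRho n k m =
  (Σ (Vertex n k → Bool) λ c → Distinguishing n k c × ∃ λ b → classSize n k c b ≡ m)
  × (∀ c → Distinguishing n k c → ∀ b → m ≤ classSize n k c b)

{-# OPTIONS --safe #-}

-- Lower bound: the vertex (i , x) sees the positions i, …, i + k - 1 of the cycle. Flipping
-- the bit at a position seen by no vertex of a colour class preserves the colouring, so the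
-- windows of the class cover the n positions. A class of at most n/k vertices must then tile
-- the cycle, and the rotation by k followed by the bit flips that carry each tile to the next
-- one is a nontrivial symmetry.
--
-- Upper bound: colour the vertices (jk , 0…0) and (1 , 10…0). Orient the edges from fibre i to
-- fibre i + 1. Since n ≥ 5, every 4-cycle lies between two consecutive fibres, whence an
-- automorphism preserves or reverses all orientations at once and acts on the fibres as a
-- rotation or a reflection. The fibres of the class have no symmetry except, for k = 2, the
-- reflection i ↦ 2 - i, which is excluded because (1 , 10) is adjacent to (2 , 00) but not to
-- (0 , 00). An automorphism that fixes every fibre acts on each position separately, and it
-- fixes the zeros because it fixes the tiles (jk , 0…0).
module Submission where

open import Defs
open import Data.Nat
open import Data.Nat.Properties
open import Data.Nat.DivMod
open import Data.Nat.Divisibility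
open import Data.Nat.ListAction using (sum)
open import Data.Nat.ListAction.Properties using (sum-++)
open import Algebra.Properties.CommutativeSemigroup +-commutativeSemigroup using (interchange)
open import Data.Bool using (Bool; true; false; not; _xor_)
import Data.Bool.Properties as Bool
open import Data.Empty using (⊥; ⊥-elim)
open import Data.Fin using (Fin; toℕ) renaming (zero to fzero; suc to fsuc)
open import Data.Fin.Properties using (toℕ-injective; toℕ-fromℕ<; toℕ<n)
open import Data.List using (List; []; _∷_; map; concatMap; filter; length; tabulate; allFin)
open import Data.List.Properties using (map-++; map-∘; map-cong)
open import Data.Product using (_×_; _,_; ∃; proj₁; proj₂)
open import Data.Sum using (_⊎_; inj₁; inj₂; [_,_]′)
open import Data.Vec using (Vec; []; _∷_; _∷ʳ_; initLast; zipWith; replicate)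
open import Data.Vec.Properties using (≡-dec)
open import Function using (_∘_; id; mk⇔)
open import Relation.Binary.PropositionalEquality
open import Relation.Nullary using (¬_; Dec; yes; no; does; contradiction; _×-dec_; _⊎-dec_)
open import Relation.Nullary.Decidable using (dec-true; dec-false; does-⇔)
open import Relation.Unary using (Decidable)

-- Bit strings and walks

bit : ∀ {k} → Vec Bool k → ℕ → Bool
bit []      _       = false
bit (a ∷ x) zero    = a
bit (a ∷ x) (suc l) = bit x l

bit-ext : ∀ {k} (x y : Vec Bool k) → (∀ l → l < k → bit x l ≡ bit y l) → x ≡ y
bit-ext []      []      h = refl
bit-ext (a ∷ x) (b ∷ y) h =
  cong₂ _∷_ (h 0 z<s) (bit-ext x y λ l l<k → h (suc l) (s<s l<k))

bit-∷ʳ : ∀ {k} (x : Vec Bool k) {a} l → l < k → bit (x ∷ʳ a) l ≡ bit x l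
bit-∷ʳ (_ ∷ _) zero    _   = refl
bit-∷ʳ (_ ∷ x) (suc l) l<k = bit-∷ʳ x l (s<s⁻¹ l<k)

bit-∷ʳ-last : ∀ {k} (x : Vec Bool k) {a} → bit (x ∷ʳ a) k ≡ a
bit-∷ʳ-last []      = refl
bit-∷ʳ-last (_ ∷ x) = bit-∷ʳ-last x

window : ∀ k → (ℕ → Bool) → ℕ → Vec Bool k
window zero    b t = []
window (suc k) b t = b t ∷ window k b (suc t)

bit-window : ∀ k b t l → l < k → bit (window k b t) l ≡ b (t + l)
bit-window (suc k) b t zero    _   = cong b (sym (+-identityʳ t))
bit-window (suc k) b t (suc l) l<k =
  trans (bit-window k b (suc t) l (s<s⁻¹ l<k)) (cong b (sym (+-suc t l)))

window-ext : ∀ k {b c t u} → (∀ l → l < k → b (t + l) ≡ c (u + l)) →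
             window k b t ≡ window k c u
window-ext k {b} {c} {t} {u} h = bit-ext _ _ λ l l<k →
  trans (bit-window k b t l l<k) (trans (h l l<k) (sym (bit-window k c u l l<k)))

window-∷ʳ : ∀ k b t → window (suc k) b t ≡ window k b t ∷ʳ b (t + k)
window-∷ʳ zero    b t = cong (λ p → b p ∷ []) (sym (+-identityʳ t))
window-∷ʳ (suc k) b t = cong (b t ∷_)
  (trans (window-∷ʳ k b (suc t)) (cong (λ p → window k b (suc t) ∷ʳ b p) (sym (+-suc t k))))

shift-bit : ∀ {k} {x y : Vec Bool (suc k)} → Shift x y → ∀ l → l < k → bit y l ≡ bit x (suc l)
shift-bit (a , b , z , refl , refl) l l<k = bit-∷ʳ z l l<k

bit-shift : ∀ {k} {x y : Vec Bool (suc k)} → (∀ l → l < k → bit y l ≡ bit x (suc l)) → Shift x y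
bit-shift {x = a ∷ z} {y} h with initLast y
... | z′ , b , refl = a , b , z , refl ,
  cong (_∷ʳ b) (bit-ext z′ z λ l l<k → trans (sym (bit-∷ʳ z′ l l<k)) (h l l<k))

splice : ℕ → (ℕ → Bool) → (ℕ → Bool) → ℕ → Bool
splice m b c s with s <? m
... | yes _ = b s
... | no  _ = c s

splice-< : ∀ {m} b c {s} → s < m → splice m b c s ≡ b s
splice-< {m} b c {s} s<m with s <? m
... | yes _   = refl
... | no  s≮m = contradiction s<m s≮m

splice-≥ : ∀ {m} b c {s} → m ≤ s → splice m b c s ≡ c s
splice-≥ {m} b c {s} m≤s with s <? m
... | yes s<m = contradiction m≤s (<⇒≱ s<m)
... | no  _   = refl

pigeonhole₃ : (a b c : Bool) → a ≡ b ⊎ a ≡ c ⊎ b ≡ c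
pigeonhole₃ false false _     = inj₁ refl
pigeonhole₃ true  true  _     = inj₁ refl
pigeonhole₃ false true  false = inj₂ (inj₁ refl)
pigeonhole₃ true  false true  = inj₂ (inj₁ refl)
pigeonhole₃ false true  true  = inj₂ (inj₂ refl)
pigeonhole₃ true  false false = inj₂ (inj₂ refl)

-- Arithmetic modulo `n` and the successor on fibres

module Residues (N : ℕ) where

  n : ℕ
  n = suc N

  toℕ-mod : ∀ t → toℕ (t mod n) ≡ t % n
  toℕ-mod t = toℕ-fromℕ< (m%n<n t n)

  mod-cong : ∀ s t → s % n ≡ t % n → s mod n ≡ t mod n
  mod-cong s t e = toℕ-injective (trans (toℕ-mod s) (trans e (sym (toℕ-mod t))))

  mod-toℕ : ∀ (i : Fin n) → toℕ i mod n ≡ i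
  mod-toℕ i = toℕ-injective (trans (toℕ-mod (toℕ i)) (m<n⇒m%n≡m (toℕ<n i)))

  toℕ-mod-< : ∀ {t} → t < n → toℕ (t mod n) ≡ t
  toℕ-mod-< {t} t<n = trans (toℕ-mod t) (m<n⇒m%n≡m t<n)

  %-+ˡ : ∀ a b → (a % n + b) % n ≡ (a + b) % n
  %-+ˡ a b = trans (%-distribˡ-+ (a % n) b n)
    (trans (cong (λ r → (r + b % n) % n) (m%n%n≡m%n a n)) (sym (%-distribˡ-+ a b n)))

  mod-+ˡ : ∀ a b → (toℕ (a mod n) + b) mod n ≡ (a + b) mod n
  mod-+ˡ a b = mod-cong (toℕ (a mod n) + b) (a + b) (trans (cong (λ r → (r + b) % n) (toℕ-mod a)) (%-+ˡ a b))

  mod-+0 : ∀ (i : Fin n) → (toℕ i + 0) mod n ≡ i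
  mod-+0 i = trans (cong (_mod n) (+-identityʳ (toℕ i))) (mod-toℕ i)

  mod-+n : ∀ t → (t + n) mod n ≡ t mod n
  mod-+n t = mod-cong (t + n) t ([m+n]%n≡m%n t n)

  toℕ-mod-+n : ∀ (i : Fin n) → (toℕ i + n) mod n ≡ i
  toℕ-mod-+n i = trans (mod-+n (toℕ i)) (mod-toℕ i)

  next-mod : ∀ t → next (t mod n) ≡ suc t mod n
  next-mod t = trans (cong (_mod n) (+-comm 1 (toℕ (t mod n))))
    (trans (mod-+ˡ t 1) (cong (_mod n) (+-comm t 1)))

  next-injective : ∀ {i j : Fin n} → next i ≡ next j → i ≡ j
  next-injective {i} {j} e = trans (sym (undo i)) (trans (cong (λ p → (toℕ p + N) mod n) e) (undo j))
    where
    undo : ∀ i → (toℕ (next i) + N) mod n ≡ i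
    undo i = trans (mod-+ˡ (suc (toℕ i)) N)
      (trans (cong (_mod n) (sym (+-suc (toℕ i) N))) (toℕ-mod-+n i))

  -- Without wrap-around the sum exceeds `i`; with it, subtracting `n` once leaves a value below
  -- `i`, because `d < n`.
  %-shift-≢ : ∀ d i → 0 < d → d < n → i < n → (i + d) % n ≢ i
  %-shift-≢ d i 0<d d<n i<n e with i + d <? n
  ... | yes i+d<n = <-irrefl (trans (sym e) (m<n⇒m%n≡m i+d<n)) (m<m+n i 0<d)
  ... | no  i+d≮n = <-irrefl (trans (sym r≡) e) r<i
    where
    n≤i+d : n ≤ i + d
    n≤i+d = ≮⇒≥ i+d≮n
    r : ℕ
    r = i + d ∸ n
    r<i : r < i
    r<i = +-cancelʳ-< n r i (subst (_< i + n) (sym (m∸n+n≡m n≤i+d)) (+-monoʳ-< i d<n))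
    r≡ : (i + d) % n ≡ r
    r≡ = trans (cong (_% n) (sym (m∸n+n≡m n≤i+d)))
      (trans ([m+n]%n≡m%n r n) (m<n⇒m%n≡m (<-trans r<i i<n)))

  mod-shift-≢ : ∀ d (i : Fin n) → 0 < d → d < n → (toℕ i + d) mod n ≢ i
  mod-shift-≢ d i 0<d d<n e =
    %-shift-≢ d (toℕ i) 0<d d<n (toℕ<n i) (trans (sym (toℕ-mod (toℕ i + d))) (cong toℕ e))

  next²-≢ : 3 ≤ n → ∀ (i : Fin n) → next (next i) ≢ i
  next²-≢ 3≤n i e = mod-shift-≢ 2 i z<s 3≤n
    (trans (cong (_mod n) (+-comm (toℕ i) 2)) (trans (sym (next-mod (suc (toℕ i)))) e))

  -- Excludes a directed 4-cycle that winds once around the fibres, as happens for `n = 4`.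
  next⁴-≢ : 5 ≤ n → ∀ (i : Fin n) → next (next (next (next i))) ≢ i
  next⁴-≢ 5≤n i e = mod-shift-≢ 4 i z<s 5≤n
    (trans (cong (_mod n) (+-comm (toℕ i) 4))
    (trans (sym (next-mod (3 + toℕ i)))
    (trans (cong next (sym (next-mod (2 + toℕ i))))
    (trans (cong (next ∘ next) (sym (next-mod (suc (toℕ i))))) e))))

-- Oriented edges, walks and 4-cycles

module Graph (N K : ℕ) (5≤n : 5 ≤ suc N) (0<K : 0 < K) (k<n : suc K < suc N) where

  open Residues N public

  k : ℕ
  k = suc K

  V : Set
  V = Vertex n k

  3≤n : 3 ≤ n
  3≤n = ≤-trans (s≤s (s≤s (s≤s z≤n))) 5≤n

  Fwd : V → V → Set
  Fwd (i , x) (j , y) = j ≡ next i × Shift x y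

  -- A bit sequence encodes an infinite directed walk. It need not be periodic, so the walk may
  -- return to a fibre at a different vertex.
  walk : (ℕ → Bool) → ℕ → V
  walk b t = t mod n , window k b t

  walk-ext : ∀ b c t → (∀ l → l < k → b (t + l) ≡ c (t + l)) → walk b t ≡ walk c t
  walk-ext b c t h = cong (t mod n ,_) (window-ext k h)

  walk-step : ∀ b t → Fwd (walk b t) (walk b (suc t))
  walk-step b t = sym (next-mod t) ,
    (b t , b (suc t + K) , window K b (suc t) , refl , window-∷ʳ K b (suc t))

  fwd-bit : ∀ {u v} → Fwd u v → ∀ l → l < K → bit (proj₂ v) l ≡ bit (proj₂ u) (suc l)
  fwd-bit (_ , s) = shift-bit s

  fwd-asym : ∀ {u v} → Fwd u v → ¬ Fwd v u
  fwd-asym (e , _) (f , _) = next²-≢ 3≤n _ (sym (trans f (cong next e)))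

  -- The target determines the fibre and all bits of the source except bit 0, so a vertex has at
  -- most two in-neighbours.
  in-neighbour-≡ : ∀ {u v w} → Fwd u w → Fwd v w → bit (proj₂ u) 0 ≡ bit (proj₂ v) 0 → u ≡ v
  in-neighbour-≡ {u} {v} {w} p q e =
    cong₂ _,_ (next-injective (trans (sym (proj₁ p)) (proj₁ q))) (bit-ext _ _ bits)
    where
    bits : ∀ l → l < k → bit (proj₂ u) l ≡ bit (proj₂ v) l
    bits zero    _   = e
    bits (suc l) l<k = trans (sym (fwd-bit p l (s<s⁻¹ l<k))) (fwd-bit q l (s<s⁻¹ l<k))

  out-neighbour-≡ : ∀ {u v w} → Fwd u v → Fwd u w → bit (proj₂ v) K ≡ bit (proj₂ w) K → v ≡ w
  out-neighbour-≡ {u} {v} {w} p q e = cong₂ _,_ (trans (proj₁ p) (sym (proj₁ q))) (bit-ext _ _ bits)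
    where
    bits : ∀ l → l < k → bit (proj₂ v) l ≡ bit (proj₂ w) l
    bits l l<k with m<1+n⇒m<n∨m≡n l<k
    ... | inj₁ l<K  = trans (fwd-bit p l l<K) (sym (fwd-bit q l l<K))
    ... | inj₂ refl = e

  -- The end `w` determines all bits of the midpoint but bit 0, and since `k ≥ 2` that one is bit 1
  -- of `u`.
  two-path-unique : ∀ {u v v′ w} → Fwd u v → Fwd u v′ → Fwd v w → Fwd v′ w → v ≡ v′
  two-path-unique p p′ q q′ =
    in-neighbour-≡ q q′ (trans (fwd-bit p 0 0<K) (sym (fwd-bit p′ 0 0<K)))

  -- Otherwise `d → a → c` climbs two fibres. The way back through `b` then gives a net displacement
  -- of 2 or 4, impossible modulo `n`, or the second directed path `d → b → c`, which forces
  -- `a ≡ b`.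
  square : ∀ {a b c d} → a ≢ b → c ≢ d →
           Adj n k a d → Adj n k b c → Adj n k b d → Fwd a c → Fwd a d
  square a≢b c≢d (inj₁ ad) _ _ ac = ad
  square a≢b c≢d (inj₂ da) (inj₁ bc) (inj₁ bd) ac =
    contradiction (trans (cong next (sym (proj₁ da))) (trans (sym (proj₁ ac)) (trans (proj₁ bc) (sym (proj₁ bd)))))
      (next²-≢ 3≤n _)
  square a≢b c≢d (inj₂ da) (inj₁ bc) (inj₂ db) ac = contradiction (two-path-unique da db ac bc) a≢b
  square a≢b c≢d (inj₂ da) (inj₂ cb) (inj₁ bd) ac =
    contradiction (sym (trans (proj₁ bd) (cong next (trans (proj₁ cb) (cong next (trans (proj₁ ac) (cong next (proj₁ da))))))))
      (next⁴-≢ 5≤n _)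
  square a≢b c≢d (inj₂ da) (inj₂ cb) (inj₂ db) ac =
    contradiction (trans (cong next (sym (proj₁ ac))) (trans (sym (proj₁ cb)) (trans (proj₁ db) (sym (proj₁ da)))))
      (next²-≢ 3≤n _)

  record Diamond (u v : V) : Set where
    field
      u′ v′ : V
      u≢u′  : u ≢ u′
      v≢v′  : v ≢ v′
      uv′   : Fwd u v′
      u′v   : Fwd u′ v
      u′v′  : Fwd u′ v′

  -- The edge drops the bit `a` and appends the bit `b`; complementing them independently gives a
  -- complete bipartite graph on two plus two vertices.
  diamond : ∀ {u v} → Fwd u v → Diamond u v
  diamond {i , _} {j , _} (refl , a , b , z , refl , refl) = record
    { u′   = i , not a ∷ z
    ; v′   = next i , z ∷ʳ not b
    ; u≢u′ = λ e → Bool.not-¬ refl (cong (λ v → bit (proj₂ v) 0) e)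
    ; v≢v′ = λ e → Bool.not-¬ refl (trans (sym (bit-∷ʳ-last z)) (trans (cong (λ v → bit (proj₂ v) K) e) (bit-∷ʳ-last z)))
    ; uv′  = refl , a , not b , z , refl , refl
    ; u′v  = refl , not a , b , z , refl , refl
    ; u′v′ = refl , not a , not b , z , refl , refl
    }

  -- Automorphisms preserve or reverse all orientations

  module Orientation (φ : Automorphism n k) where
    open Automorphism φ
    open Diamond

    σ-injective : ∀ {u v} → σ u ≡ σ v → u ≡ v
    σ-injective {u} {v} e = trans (sym (left u)) (trans (cong σ⁻¹ e) (left v))

    out-edges : ∀ {u v} → (e : Fwd u v) → Fwd (σ u) (σ v) → Fwd (σ u) (σ (v′ (diamond e)))
    out-edges e = square (u≢u′ d ∘ σ-injective) (v≢v′ d ∘ σ-injective)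
      (adj⇒ _ _ (inj₁ (uv′ d))) (adj⇒ _ _ (inj₁ (u′v d))) (adj⇒ _ _ (inj₁ (u′v′ d)))
      where d = diamond e

    in-edges : ∀ {u v} → (e : Fwd u v) → Fwd (σ u) (σ v) → Fwd (σ (u′ (diamond e))) (σ v)
    in-edges {u} {v} e p with adj⇒ _ _ (inj₁ (u′v (diamond e)))
    ... | inj₁ q = q
    -- If this edge were reversed, `square` applied at the corner `σ v` would reverse the edge from
    -- `σ u` to `σ v` as well.
    ... | inj₂ q = contradiction
      (square (v≢v′ d ∘ σ-injective) (u≢u′ d ∘ sym ∘ σ-injective)
        (adj⇒ _ _ (inj₂ e)) (adj⇒ _ _ (inj₂ (u′v′ d))) (adj⇒ _ _ (inj₂ (uv′ d))) q)
      (fwd-asym p)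
      where d = diamond e

    fwd-≢ : ∀ {u v w} → Fwd u v → Fwd v w → u ≢ w
    fwd-≢ p q refl = fwd-asym p q

    -- If the second edge were reversed, `σ v` would have three distinct in-neighbours: the images
    -- of `u`, of its diamond partner `u′`, and of `w`.
    forth : ∀ {u v w} → Fwd u v → Fwd v w → Fwd (σ u) (σ v) → Fwd (σ v) (σ w)
    forth {u} {v} {w} e f p with adj⇒ _ _ (inj₁ f)
    ... | inj₁ q = q
    ... | inj₂ q with pigeonhole₃ (bit (proj₂ (σ u)) 0) (bit (proj₂ (σ (u′ (diamond e)))) 0) (bit (proj₂ (σ w)) 0)
    ... | inj₁ r        = contradiction (σ-injective (in-neighbour-≡ p (in-edges e p) r)) (u≢u′ (diamond e))
    ... | inj₂ (inj₁ r) = contradiction (σ-injective (in-neighbour-≡ p q r)) (fwd-≢ e f)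
    ... | inj₂ (inj₂ r) = contradiction (σ-injective (in-neighbour-≡ (in-edges e p) q r)) (fwd-≢ (u′v (diamond e)) f)

    -- Dual to `forth`: otherwise `σ v` would have three distinct out-neighbours.
    back : ∀ {u v w} → Fwd u v → Fwd v w → Fwd (σ v) (σ w) → Fwd (σ u) (σ v)
    back {u} {v} {w} e f p with adj⇒ _ _ (inj₁ e)
    ... | inj₁ q = q
    ... | inj₂ q with pigeonhole₃ (bit (proj₂ (σ w)) K) (bit (proj₂ (σ (v′ (diamond f)))) K) (bit (proj₂ (σ u)) K)
    ... | inj₁ r        = contradiction (σ-injective (out-neighbour-≡ p (out-edges f p) r)) (v≢v′ (diamond f))
    ... | inj₂ (inj₁ r) = contradiction (sym (σ-injective (out-neighbour-≡ p q r))) (fwd-≢ e f)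
    ... | inj₂ (inj₂ r) = contradiction (sym (σ-injective (out-neighbour-≡ (out-edges f p) q r))) (fwd-≢ e (uv′ (diamond f)))

    Pos : (ℕ → Bool) → ℕ → Set
    Pos b t = Fwd (σ (walk b t)) (σ (walk b (suc t)))

    pos-from-0 : ∀ b t → Pos b 0 → Pos b t
    pos-from-0 b zero    p = p
    pos-from-0 b (suc t) p = forth (walk-step b t) (walk-step b (suc t)) (pos-from-0 b t p)

    pos-to-0 : ∀ b t → Pos b t → Pos b 0
    pos-to-0 b zero    p = p
    pos-to-0 b (suc t) p = pos-to-0 b t (back (walk-step b t) (walk-step b (suc t)) p)

    splice-head : ∀ b c t → t + k ≤ n → walk (splice n b c) t ≡ walk b t
    splice-head b c t h = walk-ext _ b t λ l l<k → splice-< b c (<-≤-trans (+-monoʳ-< t l<k) h)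

    splice-tail : ∀ b c t → n ≤ t → walk (splice n b c) t ≡ walk c t
    splice-tail b c t h = walk-ext _ c t λ l l<k → splice-≥ b c (≤-trans h (m≤m+n t l))

    -- The orientation is carried along a walk that starts as `b` and continues as `c` from time
    -- `n`, then back along `c` to time 0. The first edge reads positions 0 to `k` only, which
    -- precede `n`.
    pos-any : ∀ b c → Pos b 0 → Pos c 0
    pos-any b c p = pos-to-0 c n
      (subst₂ (λ u v → Fwd (σ u) (σ v)) (splice-tail b c n ≤-refl) (splice-tail b c (suc n) (n≤1+n n))
        (pos-from-0 (splice n b c) n
          (subst₂ (λ u v → Fwd (σ u) (σ v)) (sym (splice-head b c 0 (<⇒≤ k<n))) (sym (splice-head b c 1 k<n)) p)))

    orientation : (∀ b t → Pos b t) ⊎ (∀ b t → Fwd (σ (walk b (suc t))) (σ (walk b t)))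
    orientation with adj⇒ _ _ (inj₁ (walk-step (λ _ → false) 0))
    ... | inj₁ p = inj₁ λ b t → pos-from-0 b t (pos-any _ b p)
    ... | inj₂ q = inj₂ neg
      where
      neg : ∀ b t → Fwd (σ (walk b (suc t))) (σ (walk b t))
      neg b t with adj⇒ _ _ (inj₁ (walk-step b t))
      ... | inj₂ q′ = q′
      ... | inj₁ p′ = contradiction (pos-any b _ (pos-to-0 b t p′)) (fwd-asym q)

-- The colouring of the upper bound

does-true : ∀ {A : Set} (d : Dec A) → does d ≡ true → A
does-true (yes a) _ = a

bit-replicate : ∀ k l → bit (replicate k false) l ≡ false
bit-replicate zero    l       = refl
bit-replicate (suc k) zero    = refl
bit-replicate (suc k) (suc l) = bit-replicate k l

zeros : ℕ → Bool
zeros _ = false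

-- Chosen so that `walk mark 1` is the extra class vertex (1, 10...0) and all later windows are
-- zero.
mark : ℕ → Bool
mark 1 = true
mark _ = false

window-zeros : ∀ k t → window k zeros t ≡ replicate k false
window-zeros zero    t = refl
window-zeros (suc k) t = cong (false ∷_) (window-zeros k (suc t))

window-mark : ∀ k t → window k mark (2 + t) ≡ replicate k false
window-mark zero    t = refl
window-mark (suc k) t = cong (false ∷_) (window-mark k (suc t))

inverse : ∀ {n k} → Automorphism n k → Automorphism n k
inverse {n} {k} φ = record
  { σ = σ⁻¹ ; σ⁻¹ = σ ; left = right ; right = left
  ; adj⇒ = λ u v a → adj⇐ _ _ (subst₂ (Adj n k) (sym (right u)) (sym (right v)) a)
  ; adj⇐ = λ u v a → subst₂ (Adj n k) (right u) (right v) (adj⇒ _ _ a)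
  }
  where open Automorphism φ

module Colouring (N K : ℕ) (5≤n : 5 ≤ suc N) (0<K : 0 < K) (k<n : suc K < suc N)
                 (k∣n : suc K ∣ suc N) where

  open Graph N K 5≤n 0<K k<n public

  InC : V → Set
  InC (i , x) = (k ∣ toℕ i × x ≡ replicate k false) ⊎ (toℕ i ≡ 1 × x ≡ true ∷ replicate K false)

  inC? : ∀ v → Dec (InC v)
  inC? (i , x) = ((k ∣? toℕ i) ×-dec ≡-dec Bool._≟_ x (replicate k false))
           ⊎-dec ((toℕ i ≟ 1) ×-dec ≡-dec Bool._≟_ x (true ∷ replicate K false))

  colour : V → Bool
  colour v = does (inC? v)

  -- The fibres that meet the class.
  Start : ℕ → Set
  Start i = k ∣ i ⊎ i ≡ 1

  inC-start : ∀ {v} → InC v → Start (toℕ (proj₁ v))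
  inC-start (inj₁ (p , _)) = inj₁ p
  inC-start (inj₂ (p , _)) = inj₂ p

  k∤1 : ¬ k ∣ 1
  k∤1 p = <-irrefl (sym (suc-injective (∣1⇒≡1 p))) 0<K

  k∤m+1 : ∀ {m} → k ∣ m → ¬ k ∣ m + 1
  k∤m+1 p q = k∤1 (∣m+n∣m⇒∣n q p)

  -- Multiples of `k` are never consecutive, even across `n`, because `k ≥ 2` divides `n`. Hence the
  -- fibre after `r` can only be 1.
  start-step : ∀ {r} → r < n → k ∣ r → Start ((r + 1) % n) → r ≡ 0
  start-step {r} r<n k∣r (inj₁ p) = contradiction (∣n∣m%n⇒∣m {m = r + 1} k∣n p) (k∤m+1 k∣r)
  start-step {r} r<n k∣r (inj₂ e) with r + 1 <? n
  ... | yes r+1<n = +-cancelʳ-≡ 1 r 0 (trans (sym (m<n⇒m%n≡m r+1<n)) e)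
  ... | no  r+1≮n = contradiction
    (subst (k ∣_) (≤-antisym (≮⇒≥ r+1≮n) (subst (_≤ n) (+-comm 1 r) r<n)) k∣n) (k∤m+1 k∣r)

  -- The hypotheses say that the rotation by `r` sends fibres 0 and 1, and fibre 2 when `k ∣ 2`, to
  -- fibres of the class.
  rotation-trivial : ∀ {r} → r < n → Start r → Start ((r + 1) % n) →
                     (k ∣ 2 → Start ((r + 2) % n)) → r ≡ 0
  rotation-trivial r<n (inj₁ k∣r) s₁ _ = start-step r<n k∣r s₁
  -- For `r = 1`, the image 2 of fibre 1 forces `k ∣ 2`; then fibre 2 is sent to 3, which `k` cannot
  -- divide as well.
  rotation-trivial r<n (inj₂ refl) s₁ s₂ with subst Start (m<n⇒m%n≡m {m = 2} 3≤n) s₁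
  ... | inj₁ k∣2 with subst Start (m<n⇒m%n≡m {m = 3} (≤-trans (n≤1+n 4) 5≤n)) (s₂ k∣2)
  ...   | inj₁ k∣3 = contradiction k∣3 (k∤m+1 k∣2)

  -- Here `q₁` and `qₖ` are the images of fibres 1 and `k` under a reflection, so fibre 0 goes to
  -- `q₁ + 1`. If `k ∣ q₁`, the reflection swaps 0 and 1 and sends `k` to `1 - k`, which is not a
  -- fibre of the class.
  reflection-rigid : ∀ {q₁ qₖ} → q₁ < n → Start q₁ → Start ((q₁ + 1) % n) →
                     Start qₖ → (qₖ + k) % n ≡ (q₁ + 1) % n → q₁ ≡ 1 × k ∣ 2
  reflection-rigid q₁<n (inj₂ refl) s₀ _ _ with subst Start (m<n⇒m%n≡m {m = 2} 3≤n) s₀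
  ... | inj₁ k∣2 = refl , k∣2
  reflection-rigid {qₖ = qₖ} q₁<n (inj₁ k∣q₁) s₀ sₖ e with start-step q₁<n k∣q₁ s₀
  ... | refl = ⊥-elim (no-start sₖ (trans e (m<n⇒m%n≡m {m = 1} (≤-trans (n≤1+n 2) 3≤n))))
    where
    no-start : Start qₖ → (qₖ + k) % n ≢ 1
    no-start (inj₁ k∣qₖ) f = k∤1 (subst (k ∣_) f (%-presˡ-∣ {m = qₖ + k} (∣m∣n⇒∣m+n k∣qₖ ∣-refl) k∣n))
    no-start (inj₂ refl) f = %-shift-≢ k 1 z<s k<n (≤-trans (n≤1+n 2) 3≤n) f

  zeros-inC : ∀ t → k ∣ t → InC (walk zeros t)
  zeros-inC t k∣t = inj₁ (subst (k ∣_) (sym (toℕ-mod t)) (%-presˡ-∣ k∣t k∣n) , window-zeros k t)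

  mark-inC : InC (walk mark 1)
  mark-inC = inj₂ (toℕ-mod-< (≤-trans (n≤1+n 2) 3≤n) , cong (true ∷_) (window-mark K 0))

  walk-mark-2 : walk mark 2 ≡ walk zeros 2
  walk-mark-2 = cong (2 mod n ,_) (trans (window-mark k 0) (sym (window-zeros k 2)))

  inC-bit-1 : ∀ {v} → InC v → bit (proj₂ v) 1 ≡ false
  inC-bit-1 (inj₁ (_ , refl)) = bit-replicate K 0
  inC-bit-1 (inj₂ (_ , refl)) = bit-replicate K 0

  -- Automorphisms that preserve the colouring

  module Rigidity (φ : Automorphism n k)
                  (preserves : ∀ v → colour (Automorphism.σ φ v) ≡ colour v) where

    open Automorphism φ
    open Orientation φ

    σ-inC : ∀ {v} → InC v → InC (σ v)
    σ-inC {v} p = does-true (inC? (σ v)) (trans (preserves v) (dec-true (inC? v) p))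

    fibre : (ℕ → Bool) → ℕ → Fin n
    fibre b t = proj₁ (σ (walk b t))

    -- The spliced walk joins the start of `b` to the vertex of `c` one full turn later, and by
    -- hypothesis a full turn leaves the fibre of the image unchanged.
    fibre-base : (∀ b → fibre b n ≡ fibre b 0) → ∀ b c → fibre b 0 ≡ fibre c 0
    fibre-base h b c =
      trans (cong (proj₁ ∘ σ) (sym (splice-head b c 0 (<⇒≤ k<n))))
      (trans (sym (h d)) (trans (cong (proj₁ ∘ σ) (splice-tail b c n ≤-refl)) (h c)))
      where
      d : ℕ → Bool
      d = splice n b c

    start-zeros : ∀ t → k ∣ t → Start (toℕ (fibre zeros t))
    start-zeros t k∣t = inC-start (σ-inC (zeros-inC t k∣t))

    start-mark : Start (toℕ (fibre mark 1))
    start-mark = inC-start (σ-inC mark-inC)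

    not-reversing : ¬ (∀ b t → Fwd (σ (walk b (suc t))) (σ (walk b t)))
    not-reversing neg = contradiction (inC-bit-1 (σ-inC walk-mark-2-inC)) bit-1
      where
      -- The image moves down by `t` fibres; the equation is solved for time 0 to avoid subtraction.
      fibre-neg : ∀ b t → fibre b 0 ≡ (toℕ (fibre b t) + t) mod n
      fibre-neg b zero    = sym (mod-+0 (fibre b 0))
      fibre-neg b (suc t) = trans (fibre-neg b t)
        (trans (cong (λ i → (toℕ i + t) mod n) (proj₁ (neg b t)))
        (trans (mod-+ˡ (suc (toℕ (fibre b (suc t)))) t)
               (cong (_mod n) (sym (+-suc (toℕ (fibre b (suc t))) t)))))

      fibre-n : ∀ b → fibre b n ≡ fibre b 0
      fibre-n b = sym (trans (fibre-neg b n) (toℕ-mod-+n (fibre b n)))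

      mark₀ : toℕ (fibre zeros 0) ≡ (toℕ (fibre mark 1) + 1) % n
      mark₀ = trans (cong toℕ (trans (fibre-base fibre-n zeros mark) (fibre-neg mark 1))) (toℕ-mod (toℕ (fibre mark 1) + 1))

      rigid : toℕ (fibre mark 1) ≡ 1 × k ∣ 2
      rigid = reflection-rigid (toℕ<n (fibre mark 1)) start-mark
        (subst Start mark₀ (start-zeros 0 (k ∣0))) (start-zeros k ∣-refl)
        (trans (sym (trans (cong toℕ (fibre-neg zeros k)) (toℕ-mod (toℕ (fibre zeros k) + k)))) mark₀)

      walk-mark-2-inC : InC (walk mark 2)
      walk-mark-2-inC = subst InC (sym walk-mark-2) (zeros-inC 2 (proj₂ rigid))

      σ-mark : InC (σ (walk mark 1)) → bit (proj₂ (σ (walk mark 1))) 0 ≡ true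
      σ-mark (inj₁ (p , _)) = contradiction (subst (k ∣_) (proj₁ rigid) p) k∤1
      σ-mark (inj₂ (_ , e)) = cong (λ x → bit x 0) e

      -- The reversed edge runs from `σ (walk mark 2)` to `σ (walk mark 1)`, so bit 1 of the former
      -- is bit 0 of the latter. That bit is `true`, since `σ (walk mark 1)` is a class vertex in
      -- fibre 1.
      bit-1 : bit (proj₂ (σ (walk mark 2))) 1 ≢ false
      bit-1 e with trans (sym (σ-mark (σ-inC mark-inC))) (trans (fwd-bit (neg mark 1) 0 0<K) e)
      ... | ()

    forward : ∀ b t → Pos b t
    forward with orientation
    ... | inj₁ pos = pos
    ... | inj₂ neg = contradiction neg not-reversing

    fibre-pos : ∀ b t → fibre b t ≡ (toℕ (fibre b 0) + t) mod n
    fibre-pos b zero    = sym (mod-+0 (fibre b 0))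
    fibre-pos b (suc t) = trans (proj₁ (forward b t)) (trans (cong next (fibre-pos b t))
      (trans (next-mod (toℕ (fibre b 0) + t)) (cong (_mod n) (sym (+-suc (toℕ (fibre b 0)) t)))))

    fibre-const : ∀ b c → fibre b 0 ≡ fibre c 0
    fibre-const = fibre-base λ b → trans (fibre-pos b n) (toℕ-mod-+n (fibre b 0))

    fibre-from-zeros : ∀ b t → toℕ (fibre b t) ≡ (toℕ (fibre zeros 0) + t) % n
    fibre-from-zeros b t = trans (cong toℕ (trans (fibre-pos b t)
      (cong (λ i → (toℕ i + t) mod n) (fibre-const b zeros)))) (toℕ-mod (toℕ (fibre zeros 0) + t))

    fibre-zeros-0 : toℕ (fibre zeros 0) ≡ 0
    fibre-zeros-0 = rotation-trivial (toℕ<n (fibre zeros 0)) (start-zeros 0 (k ∣0))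
      (subst Start (fibre-from-zeros mark 1) start-mark)
      (λ k∣2 → subst Start (fibre-from-zeros zeros 2) (start-zeros 2 k∣2))

    fibre-walk : ∀ b t → toℕ (fibre b t) ≡ t % n
    fibre-walk b t = trans (fibre-from-zeros b t) (cong (λ r → (r + t) % n) fibre-zeros-0)

    σ-bit : (ℕ → Bool) → ℕ → ℕ → Bool
    σ-bit b t l = bit (proj₂ (σ (walk b t))) l

    -- The image of a walk is again a directed walk, so each position carries one bit, whichever
    -- window it is read from.
    σ-bit-shift : ∀ b t l → l < k → σ-bit b t l ≡ σ-bit b (t + l) 0
    σ-bit-shift b t zero    _   = cong (λ s → σ-bit b s 0) (sym (+-identityʳ t))
    σ-bit-shift b t (suc l) l<k = trans (sym (fwd-bit (forward b t) l (s<s⁻¹ l<k)))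
      (trans (σ-bit-shift b (suc t) l (<-trans (n<1+n l) l<k)) (cong (λ s → σ-bit b s 0) (sym (+-suc t l))))

    -- The image is a class vertex in the same fibre, and that fibre is not 1 because `k` divides
    -- its index.
    σ-zeros-multiple : ∀ t → k ∣ t → ∀ l → σ-bit zeros t l ≡ false
    σ-zeros-multiple t k∣t l with σ-inC (zeros-inC t k∣t)
    ... | inj₁ (_ , e) = trans (cong (λ x → bit x l) e) (bit-replicate k l)
    ... | inj₂ (e , _) = contradiction
      (subst (k ∣_) (trans (sym (fibre-walk zeros t)) e) (%-presˡ-∣ k∣t k∣n)) k∤1

    σ-zeros : ∀ t → σ-bit zeros t 0 ≡ false
    σ-zeros t = trans (cong (λ s → σ-bit zeros s 0) (trans (m≡m%n+[m/n]*n t k) (+-comm (t % k) _)))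
      (trans (sym (σ-bit-shift zeros (t / k * k) (t % k) (m%n<n t k)))
             (σ-zeros-multiple (t / k * k) (n∣m*n (t / k)) (t % k)))

    -- The walk that follows zeros up to position t + K and b from there on meets both
    -- walk zeros t and walk b (t + K), whose windows overlap in the single position t + K.
    σ-zero-bit : ∀ b t → b (t + K) ≡ false → σ-bit b (t + K) 0 ≡ false
    σ-zero-bit b t e =
      trans (cong (λ v → bit (proj₂ (σ v)) 0) (sym (walk-ext d b (t + K) λ l _ → splice-≥ zeros b (m≤m+n (t + K) l))))
      (trans (sym (σ-bit-shift d t K (n<1+n K)))
      (trans (cong (λ v → bit (proj₂ (σ v)) K) (walk-ext d zeros t λ l l<k → d-zero l (m<1+n⇒m<n∨m≡n l<k)))
      (trans (σ-bit-shift zeros t K (n<1+n K)) (σ-zeros (t + K)))))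
      where
      d : ℕ → Bool
      d = splice (t + K) zeros b
      d-zero : ∀ l → l < K ⊎ l ≡ K → d (t + l) ≡ false
      d-zero l (inj₁ l<K)  = splice-< zeros b (+-monoʳ-< t l<K)
      d-zero l (inj₂ refl) = trans (splice-≥ zeros b ≤-refl) e

    -- The vertex is met at time `toℕ i + n` instead of `toℕ i`, which leaves room for the `K`
    -- earlier positions that `σ-zero-bit` looks back to.
    reading : V → ℕ → Bool
    reading (i , x) s = bit x (s ∸ (toℕ i + n))

    walk-reading : ∀ v → walk (reading v) (toℕ (proj₁ v) + n) ≡ v
    walk-reading v@(i , x) = cong₂ _,_ (toℕ-mod-+n i)
      (bit-ext _ x λ l l<k → trans (bit-window k (reading v) (toℕ i + n) l l<k)
        (cong (bit x) (m+n∸m≡n (toℕ i + n) l)))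

    fibre-fixed : ∀ v → proj₁ (σ v) ≡ proj₁ v
    fibre-fixed v@(i , x) = trans (cong (proj₁ ∘ σ) (sym (walk-reading v)))
      (toℕ-injective (trans (fibre-walk (reading v) (toℕ i + n))
        (trans ([m+n]%n≡m%n (toℕ i) n) (m<n⇒m%n≡m (toℕ<n i)))))

    zero-fixed : ∀ v l → l < k → bit (proj₂ v) l ≡ false → bit (proj₂ (σ v)) l ≡ false
    zero-fixed v@(i , x) l l<k e =
      trans (cong (λ w → bit (proj₂ (σ w)) l) (sym (walk-reading v)))
      (trans (σ-bit-shift (reading v) t l l<k)
      (trans (cong (λ s → σ-bit (reading v) s 0) (sym s≡))
        (σ-zero-bit (reading v) s (trans (cong (reading v) s≡) (trans (cong (bit x) (m+n∸m≡n t l)) e)))))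
      where
      t s : ℕ
      t = toℕ i + n
      -- The time whose window ends at position `t + l`; the subtraction is exact because
      -- `K ≤ n ≤ t`.
      s = t + l ∸ K
      s≡ : s + K ≡ t + l
      s≡ = m∸n+n≡m (≤-trans (<⇒≤ (<-trans (n<1+n K) k<n)) (≤-trans (m≤n+m n (toℕ i)) (m≤m+n t l)))

  -- Zeros are fixed by `σ`. Ones are fixed too, since `σ⁻¹` also preserves the colouring and
  -- therefore fixes zeros.
  distinguishing : Distinguishing n k colour
  distinguishing φ preserves v = cong₂ _,_ (R.fibre-fixed v) (bit-ext _ _ bits)
    where
    open Automorphism φ
    module R = Rigidity φ preserves
    module R⁻¹ = Rigidity (inverse φ) (λ v → trans (sym (preserves (σ⁻¹ v))) (cong colour (right v)))
    bits : ∀ l → l < k → bit (proj₂ (σ v)) l ≡ bit (proj₂ v) l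
    bits l l<k with bit (proj₂ v) l in e | bit (proj₂ (σ v)) l in f
    ... | false | false = refl
    ... | true  | true  = refl
    ... | false | true  = trans (sym f) (R.zero-fixed v l l<k e)
    ... | true  | false = trans (sym (R⁻¹.zero-fixed (σ v) l l<k f)) (trans (cong (λ w → bit (proj₂ w) l) (left v)) e)

-- Counting

Σ< : ℕ → (ℕ → ℕ) → ℕ
Σ< zero    f = 0
Σ< (suc m) f = f 0 + Σ< m (f ∘ suc)

Σ-cong : ∀ m {f g} → (∀ i → i < m → f i ≡ g i) → Σ< m f ≡ Σ< m g
Σ-cong zero    h = refl
Σ-cong (suc m) h = cong₂ _+_ (h 0 z<s) (Σ-cong m λ i i<m → h (suc i) (s<s i<m))

Σ-+ : ∀ m f g → Σ< m (λ i → f i + g i) ≡ Σ< m f + Σ< m g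
Σ-+ zero    f g = refl
Σ-+ (suc m) f g = trans (cong (f 0 + g 0 +_) (Σ-+ m (f ∘ suc) (g ∘ suc)))
  (interchange (f 0) (g 0) (Σ< m (f ∘ suc)) (Σ< m (g ∘ suc)))

Σ-zero : ∀ m → Σ< m (λ _ → 0) ≡ 0
Σ-zero zero    = refl
Σ-zero (suc m) = Σ-zero m

Σ-split : ∀ a b f → Σ< (a + b) f ≡ Σ< a f + Σ< b (λ i → f (a + i))
Σ-split zero    b f = refl
Σ-split (suc a) b f = trans (cong (f 0 +_) (Σ-split a b (f ∘ suc))) (sym (+-assoc (f 0) _ _))

Σ-last : ∀ m f → Σ< (suc m) f ≡ Σ< m f + f m
Σ-last zero    f = +-identityʳ (f 0)
Σ-last (suc m) f = trans (cong (f 0 +_) (Σ-last m (f ∘ suc))) (sym (+-assoc (f 0) _ _))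

Σ-term : ∀ m f {i} → i < m → f i ≤ Σ< m f
Σ-term (suc m) f {zero}  _   = m≤m+n (f 0) _
Σ-term (suc m) f {suc i} i<m = ≤-trans (Σ-term m (f ∘ suc) (s<s⁻¹ i<m)) (m≤n+m _ (f 0))

Σ-positive : ∀ m f → 1 ≤ Σ< m f → ∃ λ i → i < m × 1 ≤ f i
Σ-positive (suc m) f h with f 0 in e
... | suc _ = 0 , z<s , subst (1 ≤_) (sym e) (s≤s z≤n)
... | zero with Σ-positive m (f ∘ suc) h
...   | i , i<m , p = suc i , s<s i<m , p

Σ-≤1 : ∀ m f {i j} → Σ< m f ≤ 1 → i < m → j < m → 1 ≤ f i → 1 ≤ f j → i ≡ j
Σ-≤1 (suc m) f {zero}  {zero}  h _ _ _ _ = refl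
Σ-≤1 (suc m) f {suc i} {suc j} h i<m j<m p q =
  cong suc (Σ-≤1 m (f ∘ suc) (≤-trans (m≤n+m _ (f 0)) h) (s<s⁻¹ i<m) (s<s⁻¹ j<m) p q)
Σ-≤1 (suc m) f {zero}  {suc j} h _ j<m p q =
  contradiction (≤-trans (+-mono-≤ p (≤-trans q (Σ-term m (f ∘ suc) (s<s⁻¹ j<m)))) h) 1+n≰n
Σ-≤1 (suc m) f {suc i} {zero}  h i<m _ p q =
  contradiction (≤-trans (+-mono-≤ q (≤-trans p (Σ-term m (f ∘ suc) (s<s⁻¹ i<m)))) h) 1+n≰n

Σ-≥ : ∀ m f → (∀ i → i < m → 1 ≤ f i) → m ≤ Σ< m f
Σ-≥ zero    f h = z≤n
Σ-≥ (suc m) f h = +-mono-≤ (h 0 z<s) (Σ-≥ m (f ∘ suc) λ i i<m → h (suc i) (s<s i<m))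

Σ-all-1 : ∀ m f → (∀ i → i < m → 1 ≤ f i) → Σ< m f ≤ m → ∀ i → i < m → f i ≡ 1
Σ-all-1 (suc m) f h s zero    _   =
  ≤-antisym (+-cancelʳ-≤ m (f 0) 1 (≤-trans (+-monoʳ-≤ (f 0) (Σ-≥ m (f ∘ suc) λ i i<m → h (suc i) (s<s i<m))) s)) (h 0 z<s)
Σ-all-1 (suc m) f h s (suc i) i<m = Σ-all-1 m (f ∘ suc) (λ i i<m → h (suc i) (s<s i<m))
  (s≤s⁻¹ (≤-trans (+-monoˡ-≤ _ (h 0 z<s)) s)) i (s<s⁻¹ i<m)

Periodic : ∀ {A : Set} → ℕ → (ℕ → A) → Set
Periodic n f = ∀ t → f (t + n) ≡ f t

periodic-% : ∀ {A : Set} n .{{_ : NonZero n}} (f : ℕ → A) → Periodic n f → ∀ t → f (t % n) ≡ f t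
periodic-% n f per t = trans (sym (go (t / n))) (cong f (sym (m≡m%n+[m/n]*n t n)))
  where
  go : ∀ q → f (t % n + q * n) ≡ f (t % n)
  go zero    = cong f (+-identityʳ (t % n))
  go (suc q) = trans (cong f (trans (cong (t % n +_) (+-comm n (q * n))) (sym (+-assoc (t % n) (q * n) n))))
    (trans (per (t % n + q * n)) (go q))

-- Adding `f 0`, which equals `f n`, turns both sides into the sum of the first `n + 1` terms.
Σ-rotate : ∀ n f → Periodic n f → Σ< n (f ∘ suc) ≡ Σ< n f
Σ-rotate n f per = +-cancelˡ-≡ (f 0) _ _
  (trans (Σ-last n f) (trans (cong (Σ< n f +_) (per 0)) (+-comm (Σ< n f) (f 0))))

-- Double counting: each of the `k` offsets contributes a rotated copy of the full sum.
Σ-windows : ∀ n k f → Periodic n f → Σ< n (λ q → Σ< k (λ j → f (q + j))) ≡ k * Σ< n f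
Σ-windows n zero    f per = Σ-zero n
Σ-windows n (suc k) f per = trans (Σ-+ n (λ q → f (q + 0)) _) (cong₂ _+_
  (Σ-cong n λ q _ → cong f (+-identityʳ q))
  (trans (Σ-cong n λ q _ → Σ-cong k λ j _ → cong f (+-suc q j))
    (trans (Σ-windows n k (f ∘ suc) (per ∘ suc)) (cong (k *_) (Σ-rotate n f per)))))

indicator : Bool → ℕ
indicator true  = 1
indicator false = 0

-- The range splits into `m` blocks of length `suc K`, each with its only multiple in front.
Σ-multiples : ∀ K m → Σ< (m * suc K) (λ t → indicator (does (suc K ∣? t))) ≡ m
Σ-multiples K zero    = refl
Σ-multiples K (suc m) = trans (Σ-split k (m * k) (indicator ∘ does ∘ (k ∣?_)))
  (cong₂ _+_ first (trans (Σ-cong (m * k) λ t _ → cong indicator (shift t)) (Σ-multiples K m)))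
  where
  k : ℕ
  k = suc K
  shift : ∀ t → does (k ∣? (k + t)) ≡ does (k ∣? t)
  shift t = does-⇔ (mk⇔ (λ p → ∣m+n∣m⇒∣n p ∣-refl) (∣m∣n⇒∣m+n ∣-refl)) (k ∣? (k + t)) (k ∣? t)
  first : Σ< k (indicator ∘ does ∘ (k ∣?_)) ≡ 1
  first = cong₂ _+_ (cong indicator (dec-true (k ∣? 0) (k ∣0)))
    (trans (Σ-cong K λ i i<K → cong indicator (dec-false (k ∣? suc i) λ p → <⇒≱ (s<s i<K) (∣⇒≤ p))) (Σ-zero K))

-- Class sizes as sums over fibres

tally : ∀ {A : Set} → (A → Bool) → List A → ℕ
tally P xs = sum (map (indicator ∘ P) xs)

length-filter-tally : ∀ {A : Set} {P : A → Set} (P? : Decidable P) xs →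
                      length (filter P? xs) ≡ tally (does ∘ P?) xs
length-filter-tally P? []       = refl
length-filter-tally P? (x ∷ xs) with does (P? x)
... | true  = cong suc (length-filter-tally P? xs)
... | false = length-filter-tally P? xs

tally-concatMap : ∀ {A B : Set} (P : B → Bool) (g : A → List B) xs →
                  tally P (concatMap g xs) ≡ sum (map (tally P ∘ g) xs)
tally-concatMap P g []       = refl
tally-concatMap P g (x ∷ xs) = trans (cong sum (map-++ (indicator ∘ P) (g x) (concatMap g xs)))
  (trans (sum-++ (map (indicator ∘ P) (g x)) _) (cong (tally P (g x) +_) (tally-concatMap P g xs)))

sum-map-+ : ∀ {A : Set} (f g : A → ℕ) xs → sum (map (λ x → f x + g x) xs) ≡ sum (map f xs) + sum (map g xs)
sum-map-+ f g []       = refl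
sum-map-+ f g (x ∷ xs) = trans (cong (f x + g x +_) (sum-map-+ f g xs))
  (interchange (f x) (g x) (sum (map f xs)) (sum (map g xs)))

sum-map-tabulate : ∀ {A : Set} m (g : Fin m → A) h f → (∀ i → h (g i) ≡ f (toℕ i)) →
                   sum (map h (tabulate g)) ≡ Σ< m f
sum-map-tabulate zero    g h f e = refl
sum-map-tabulate (suc m) g h f e =
  cong₂ _+_ (e fzero) (sum-map-tabulate m (g ∘ fsuc) h (f ∘ suc) (e ∘ fsuc))

count : ∀ k → (Vec Bool k → Bool) → ℕ
count zero    P = indicator (P [])
count (suc k) P = count k (P ∘ (false ∷_)) + count k (P ∘ (true ∷_))

tally-allVecs : ∀ k P → tally P (allVecs k) ≡ count k P
tally-allVecs zero    P = +-identityʳ _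
tally-allVecs (suc k) P =
  trans (tally-concatMap P (λ v → (false ∷ v) ∷ (true ∷ v) ∷ []) (allVecs k))
  (trans (cong sum (map-cong (λ v → cong (indicator (P (false ∷ v)) +_) (+-identityʳ _)) (allVecs k)))
  (trans (sum-map-+ (indicator ∘ P ∘ (false ∷_)) (indicator ∘ P ∘ (true ∷_)) (allVecs k))
    (cong₂ _+_ (tally-allVecs k (P ∘ (false ∷_))) (tally-allVecs k (P ∘ (true ∷_))))))

count-≥1 : ∀ k P v → P v ≡ true → 1 ≤ count k P
count-≥1 zero    P []          p = subst (λ b → 1 ≤ indicator b) (sym p) (s≤s z≤n)
count-≥1 (suc k) P (false ∷ v) p = ≤-trans (count-≥1 k (P ∘ (false ∷_)) v p) (m≤m+n _ _)
count-≥1 (suc k) P (true ∷ v)  p = ≤-trans (count-≥1 k (P ∘ (true ∷_)) v p) (m≤n+m _ _)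

-- The lexicographically least solution, with the all-ones string as default if there is none.
choose : ∀ k → (Vec Bool k → Bool) → Vec Bool k
choose zero    P = []
choose (suc k) P with count k (P ∘ (false ∷_))
... | suc _ = false ∷ choose k (P ∘ (false ∷_))
... | zero  = true ∷ choose k (P ∘ (true ∷_))

choose-true : ∀ k P → 1 ≤ count k P → P (choose k P) ≡ true
choose-true zero    P h with P []
... | true = refl
choose-true (suc k) P h with count k (P ∘ (false ∷_)) in e
... | suc _ = choose-true k (P ∘ (false ∷_)) (subst (1 ≤_) (sym e) (s≤s z≤n))
... | zero  = choose-true k (P ∘ (true ∷_)) h

count-unique : ∀ k P {v w} → count k P ≤ 1 → P v ≡ true → P w ≡ true → v ≡ w
count-unique zero    P {[]}        {[]}        h p q = refl
count-unique (suc k) P {false ∷ v} {false ∷ w} h p q =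
  cong (false ∷_) (count-unique k (P ∘ (false ∷_)) (≤-trans (m≤m+n _ _) h) p q)
count-unique (suc k) P {true ∷ v}  {true ∷ w}  h p q =
  cong (true ∷_) (count-unique k (P ∘ (true ∷_)) (≤-trans (m≤n+m _ _) h) p q)
count-unique (suc k) P {false ∷ v} {true ∷ w}  h p q = contradiction
  (≤-trans (+-mono-≤ (count-≥1 k (P ∘ (false ∷_)) v p) (count-≥1 k (P ∘ (true ∷_)) w q)) h) 1+n≰n
count-unique (suc k) P {true ∷ v}  {false ∷ w} h p q = contradiction
  (≤-trans (+-mono-≤ (count-≥1 k (P ∘ (false ∷_)) w q) (count-≥1 k (P ∘ (true ∷_)) v p)) h) 1+n≰n

count-0 : ∀ k P → (∀ v → P v ≢ true) → count k P ≡ 0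
count-0 zero    P h with P [] in e
... | true  = contradiction e (h [])
... | false = refl
count-0 (suc k) P h = cong₂ _+_ (count-0 k (P ∘ (false ∷_)) (h ∘ (false ∷_))) (count-0 k (P ∘ (true ∷_)) (h ∘ (true ∷_)))

count-1 : ∀ k P v → P v ≡ true → (∀ w → P w ≡ true → w ≡ v) → count k P ≡ 1
count-1 zero    P []          p u = cong indicator p
count-1 (suc k) P (false ∷ v) p u = cong₂ _+_
  (count-1 k (P ∘ (false ∷_)) v p λ w q → cong (λ { (_ ∷ x) → x }) (u (false ∷ w) q))
  (count-0 k (P ∘ (true ∷_)) λ w q → contradiction (u (true ∷ w) q) λ ())
count-1 (suc k) P (true ∷ v)  p u = cong₂ _+_
  (count-0 k (P ∘ (false ∷_)) λ w q → contradiction (u (false ∷ w) q) λ ())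
  (count-1 k (P ∘ (true ∷_)) v p λ w q → cong (λ { (_ ∷ x) → x }) (u (true ∷ w) q))

-- Indexed by all natural numbers through `mod`, so that sums over windows may run past the last
-- fibre.
fibreSize : ∀ N k → (Vertex (suc N) k → Bool) → Bool → ℕ → ℕ
fibreSize N k c b t = count k (λ x → does (c (t mod suc N , x) Bool.≟ b))

classSize-Σ : ∀ N k c b → classSize (suc N) k c b ≡ Σ< (suc N) (fibreSize N k c b)
classSize-Σ N k c b = trans (length-filter-tally (λ v → c v Bool.≟ b) (allVertices (suc N) k))
  (trans (tally-concatMap P (λ i → map (i ,_) (allVecs k)) (allFin (suc N)))
    (sum-map-tabulate (suc N) id _ (fibreSize N k c b) λ i →
      trans (cong sum (sym (map-∘ (allVecs k))))
      (trans (tally-allVecs k (λ x → P (i , x)))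
        (cong (λ i → count k (λ x → P (i , x))) (sym (Residues.mod-toℕ N i))))))
  where
  P : Vertex (suc N) k → Bool
  P v = does (c v Bool.≟ b)

-- Flips and rotations

infixl 6 _⊕_
_⊕_ : ∀ {k} → Vec Bool k → Vec Bool k → Vec Bool k
_⊕_ = zipWith _xor_

bit-⊕ : ∀ {k} (x y : Vec Bool k) l → bit (x ⊕ y) l ≡ bit x l xor bit y l
bit-⊕ []      []      l       = refl
bit-⊕ (a ∷ x) (b ∷ y) zero    = refl
bit-⊕ (a ∷ x) (b ∷ y) (suc l) = bit-⊕ x y l

⊕-involutive : ∀ {k} (x y : Vec Bool k) → x ⊕ y ⊕ y ≡ x
⊕-involutive []      []      = refl
⊕-involutive (a ∷ x) (b ∷ y) = cong₂ _∷_
  (trans (Bool.xor-assoc a b b) (trans (cong (a xor_) (Bool.xor-same b)) (Bool.xor-identityʳ a))) (⊕-involutive x y)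

⊕-cancel : ∀ {k} (x y : Vec Bool k) → x ⊕ (x ⊕ y) ≡ y
⊕-cancel []      []      = refl
⊕-cancel (a ∷ x) (b ∷ y) = cong₂ _∷_
  (trans (sym (Bool.xor-assoc a a b)) (cong (_xor b) (Bool.xor-same a))) (⊕-cancel x y)

-- With two colours, a map that preserves one class in both directions preserves the colouring.
≡-from-⇔ : ∀ {a a′ b : Bool} → (a ≡ b → a′ ≡ b) → (a′ ≡ b → a ≡ b) → a′ ≡ a
≡-from-⇔ {false} {false} f g = refl
≡-from-⇔ {true}  {true}  f g = refl
≡-from-⇔ {false} {true}  {false} f g = f refl
≡-from-⇔ {false} {true}  {true}  f g = sym (g refl)
≡-from-⇔ {true}  {false} {false} f g = sym (g refl)
≡-from-⇔ {true}  {false} {true}  f g = f refl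

module Symmetries (N K : ℕ) (5≤n : 5 ≤ suc N) (0<K : 0 < K) (k<n : suc K < suc N) where

  open Graph N K 5≤n 0<K k<n public

  fromFwd : (σ σ⁻¹ : V → V) → (∀ v → σ⁻¹ (σ v) ≡ v) → (∀ v → σ (σ⁻¹ v) ≡ v) →
            (∀ u v → Fwd u v → Fwd (σ u) (σ v)) → (∀ u v → Fwd u v → Fwd (σ⁻¹ u) (σ⁻¹ v)) →
            Automorphism n k
  fromFwd σ σ⁻¹ left right f g = record
    { σ = σ ; σ⁻¹ = σ⁻¹ ; left = left ; right = right
    ; adj⇒ = λ u v → [ inj₁ ∘ f u v , inj₂ ∘ f v u ]′
    ; adj⇐ = λ u v a → subst₂ (Adj n k) (left u) (left v)
        ([ inj₁ ∘ g (σ u) (σ v) , inj₂ ∘ g (σ v) (σ u) ]′ a) }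

  rotate : ℕ → V → V
  rotate r (i , x) = (toℕ i + r) mod n , x

  rotate-fwd : ∀ r u v → Fwd u v → Fwd (rotate r u) (rotate r v)
  rotate-fwd r (i , _) (j , _) (refl , s) =
    trans (mod-+ˡ (suc (toℕ i)) r) (sym (next-mod (toℕ i + r))) , s

  rotate-inverse : ∀ r s → r + s ≡ n → ∀ v → rotate s (rotate r v) ≡ v
  rotate-inverse r s e (i , x) = cong (_, x) (trans (mod-+ˡ (toℕ i + r) s)
    (trans (cong (_mod n) (trans (+-assoc (toℕ i) r s) (cong (toℕ i +_) e))) (toℕ-mod-+n i)))

  flip : (ℕ → Bool) → V → V
  flip g (i , x) = i , x ⊕ window k g (toℕ i)

  flip-involutive : ∀ g v → flip g (flip g v) ≡ v
  flip-involutive g (i , x) = cong (i ,_) (⊕-involutive x (window k g (toℕ i)))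

  periodic-+ : ∀ {A : Set} (g : ℕ → A) → Periodic n g → ∀ s l → g (s % n + l) ≡ g (s + l)
  periodic-+ g per s l = trans (sym (periodic-% n g per (s % n + l)))
    (trans (cong g (%-+ˡ s l)) (periodic-% n g per (s + l)))

  window-mod : ∀ g → Periodic n g → ∀ t → window k g (toℕ (t mod n)) ≡ window k g t
  window-mod g per t = window-ext k λ l _ →
    trans (cong (λ s → g (s + l)) (toℕ-mod t)) (periodic-+ g per t l)

  -- Adjacent vertices share `K` positions of the cycle and `g` treats each of them alike in both
  -- windows; periodicity covers the edge from the last fibre to fibre 0.
  flip-fwd : ∀ g → Periodic n g → ∀ u v → Fwd u v → Fwd (flip g u) (flip g v)
  flip-fwd g per (i , x) (_ , y) (refl , s) = refl , bit-shift λ l l<K →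
    trans (bit-⊕ y _ l)
    (trans (cong₂ _xor_ (shift-bit s l l<K)
      (trans (cong (λ w → bit w l) (window-mod g per (suc (toℕ i))))
      (trans (bit-window k g (suc (toℕ i)) l (<-trans l<K (n<1+n K)))
      (trans (cong g (sym (+-suc (toℕ i) l)))
             (sym (bit-window k g (toℕ i) (suc l) (s<s l<K)))))))
    (sym (bit-⊕ x _ (suc l))))

  flip-automorphism : ∀ g → Periodic n g → Automorphism n k
  flip-automorphism g per = fromFwd (flip g) (flip g) (flip-involutive g) (flip-involutive g) (flip-fwd g per) (flip-fwd g per)

  flip-rotate-automorphism : ∀ g → Periodic n g → ∀ r s → r + s ≡ n → Automorphism n k
  flip-rotate-automorphism g per r s e = fromFwd (flip g ∘ rotate r) (rotate s ∘ flip g)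
    (λ v → trans (cong (rotate s) (flip-involutive g (rotate r v))) (rotate-inverse r s e v))
    (λ v → trans (cong (flip g) (rotate-inverse s r (trans (+-comm s r) e) (flip g v))) (flip-involutive g v))
    (λ u v → flip-fwd g per _ _ ∘ rotate-fwd r u v)
    (λ u v → rotate-fwd s _ _ ∘ flip-fwd g per u v)

  mod-cancel : ∀ a b l → (a + l) mod n ≡ (b + l) mod n → a mod n ≡ b mod n
  mod-cancel a b zero    e = subst₂ (λ p q → p mod n ≡ q mod n) (+-identityʳ a) (+-identityʳ b) e
  mod-cancel a b (suc l) e = mod-cancel a b l (next-injective
    (trans (next-mod (a + l)) (trans (cong (_mod n) (sym (+-suc a l)))
    (trans e (trans (cong (_mod n) (+-suc b l)) (sym (next-mod (b + l))))))))

-- The lower bound: windows of a class cover the cycle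

module LowerBound (N K : ℕ) (5≤n : 5 ≤ suc N) (0<K : 0 < K) (k<n : suc K < suc N)
                  (m : ℕ) (n≡m*k : suc N ≡ m * suc K)
                  (c : Vertex (suc N) (suc K) → Bool) (distinguishing : Distinguishing (suc N) (suc K) c)
                  (b : Bool) where

  open Symmetries N K 5≤n 0<K k<n

  InFibre : ℕ → Vec Bool k → Bool
  InFibre t x = does (c (t mod n , x) Bool.≟ b)

  size : ℕ → ℕ
  size = fibreSize N k c b

  -- Fibres `q` to `q + K` are those whose windows contain position `q + K`, so this counts the
  -- class vertices that see that position.
  coverage : ℕ → ℕ
  coverage q = Σ< k (λ j → size (q + j))

  size-periodic : Periodic n size
  size-periodic t = cong (λ i → count k (λ x → does (c (i , x) Bool.≟ b))) (mod-+n t)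

  in-fibre : ∀ {i x} → c (i , x) ≡ b → InFibre (toℕ i) x ≡ true
  in-fibre {i} {x} e = dec-true (_ Bool.≟ _) (trans (cong (λ i → c (i , x)) (mod-toℕ i)) e)

  size-≥1 : ∀ {i x} → c (i , x) ≡ b → 1 ≤ size (toℕ i)
  size-≥1 {i} {x} e = count-≥1 k (InFibre (toℕ i)) x (in-fibre e)

  coverage-≥1 : ∀ q → 1 ≤ coverage q
  coverage-≥1 q with coverage q in cov≡0
  ... | suc _ = s≤s z≤n
  ... | zero  = contradiction (cong (λ v → bit (proj₂ v) 0) (distinguishing φ preserves (r , replicate k false))) moved
    where
    r : Fin n
    r = (q + K) mod n
    at-r : ℕ → Bool
    at-r p = does (p % n ≟ toℕ r)
    at-r-periodic : Periodic n at-r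
    at-r-periodic p = cong (λ s → does (s ≟ toℕ r)) ([m+n]%n≡m%n p n)
    φ : Automorphism n k
    φ = flip-automorphism at-r at-r-periodic
    -- A class vertex that sees `r` at place `l` would lie in fibre `q + (K ∸ l)`, one of those
    -- counted by `coverage q`.
    unseen : ∀ {i x} → c (i , x) ≡ b → ∀ l → l < k → at-r (toℕ i + l) ≡ false
    unseen {i} e l l<k = dec-false (_ ≟ _) λ i+l≡r →
      <⇒≱ (subst (1 ≤_) (sym (size-q i+l≡r)) (size-≥1 e))
          (subst (size (q + (K ∸ l)) ≤_) cov≡0 (Σ-term k (λ j → size (q + j)) {K ∸ l} (s≤s (m∸n≤m K l))))
      where
      size-q : (toℕ i + l) % n ≡ toℕ r → size (q + (K ∸ l)) ≡ size (toℕ i)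
      size-q i+l≡r = cong (λ i → count k (λ x → does (c (i , x) Bool.≟ b)))
        (mod-cancel (q + (K ∸ l)) (toℕ i) l
          (trans (cong (_mod n) (trans (+-assoc q (K ∸ l) l) (cong (q +_) (m∸n+n≡m (s≤s⁻¹ l<k)))))
            (toℕ-injective (trans (sym i+l≡r) (sym (toℕ-mod (toℕ i + l)))))))
    fixes : ∀ v → c v ≡ b → flip at-r v ≡ v
    fixes (i , x) e = cong (i ,_) (bit-ext _ x λ l l<k → trans (bit-⊕ x _ l)
      (trans (cong (bit x l xor_) (trans (bit-window k at-r (toℕ i) l l<k) (unseen e l l<k))) (Bool.xor-identityʳ _)))
    preserves : ∀ v → c (flip at-r v) ≡ c v
    preserves v = ≡-from-⇔ (λ e → trans (cong c (fixes v e)) e)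
      (λ e → trans (cong c (trans (sym (flip-involutive at-r v)) (fixes (flip at-r v) e))) e)
    moved : bit (replicate k false ⊕ window k at-r (toℕ r)) 0 ≢ false
    moved e with trans (sym (dec-true (toℕ r % n ≟ toℕ r) (m<n⇒m%n≡m (toℕ<n r)))) e
    ... | ()

  -- A class of at most `n / k` vertices tiles the cycle

  module Tiling (few : Σ< n size ≤ m) where

    -- Over one turn the coverages add up to `k` times the class size, hence to at most `n`, while
    -- each of the `n` terms is at least 1.
    coverage-1 : ∀ q → coverage q ≡ 1
    coverage-1 q = trans (sym (Σ-cong k λ j _ → periodic-+ size size-periodic q j))
      (Σ-all-1 n coverage (λ q _ → coverage-≥1 q)
        (≤-trans (≤-reflexive (Σ-windows n k size size-periodic))
        (≤-trans (*-monoʳ-≤ k few) (≤-reflexive (trans (*-comm k m) (sym n≡m*k)))))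
        (q % n) (m%n<n q n))

    -- The coverages at `q` and `suc q` are equal and share all terms but `size q` and
    -- `size (q + k)`.
    size-k-periodic : Periodic k size
    size-k-periodic q = +-cancelˡ-≡ S _ _
      (trans (cong (λ p → S + size p) (+-suc q K))
      (trans (sym (Σ-last K (λ j → size (suc q + j))))
      (trans (coverage-1 (suc q))
      (trans (sym (coverage-1 q))
      (trans (cong₂ _+_ (cong size (+-identityʳ q)) (Σ-cong K λ j _ → cong size (+-suc q j)))
             (+-comm (size q) S))))))
      where
      S : ℕ
      S = Σ< K (λ j → size (suc q + j))

    size-≤1 : ∀ t → size t ≤ 1
    size-≤1 t = subst₂ _≤_ (cong size (+-identityʳ t)) (coverage-1 t)
      (Σ-term k (λ j → size (t + j)) z<s)

    first : ∃ λ i → i < k × 1 ≤ size i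
    first = Σ-positive k size (≤-reflexive (sym (coverage-1 0)))

    i₀ : ℕ
    i₀ = proj₁ first

    -- Reduction modulo `k` keeps the size, and `coverage 0 ≡ 1` leaves one occupied fibre below
    -- `k`.
    residue : ∀ i → 1 ≤ size i → i % k ≡ i₀
    residue i p = Σ-≤1 k size (≤-reflexive (coverage-1 0)) (m%n<n i k) (proj₁ (proj₂ first))
      (subst (1 ≤_) (sym (periodic-% k size size-k-periodic i)) p) (proj₂ (proj₂ first))

    tile : ℕ → Vec Bool k
    tile t = choose k (InFibre t)

    tile-mod : ∀ s t → s mod n ≡ t mod n → tile s ≡ tile t
    tile-mod _ _ e = cong (λ i → choose k (λ x → does (c (i , x) Bool.≟ b))) e

    tile-∈ : ∀ t → 1 ≤ size t → c (t mod n , tile t) ≡ b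
    tile-∈ t p = does-true (_ Bool.≟ _) (choose-true k (InFibre t) p)

    tile-unique : ∀ {i x} → c (i , x) ≡ b → x ≡ tile (toℕ i)
    tile-unique {i} e = count-unique k (InFibre (toℕ i)) (size-≤1 (toℕ i))
      (in-fibre e) (choose-true k (InFibre (toℕ i)) (size-≥1 e))

    n∸k : ℕ
    n∸k = n ∸ k

    k+[n∸k]≡n : k + n∸k ≡ n
    k+[n∸k]≡n = m+[n∸m]≡n (<⇒≤ k<n)

    -- Since `n∸k` stands for `- k` modulo `n`, this is the flip that carries the preceding tile to
    -- the tile at `t`.
    difference : ℕ → Vec Bool k
    difference t = tile (t + n∸k) ⊕ tile t

    difference-periodic : Periodic n difference
    difference-periodic t = cong₂ _⊕_
      (tile-mod (t + n + n∸k) (t + n∸k) (trans (cong (_mod n) (trans (+-assoc t n n∸k) (trans (cong (t +_) (+-comm n n∸k)) (sym (+-assoc t n∸k n)))))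
        (mod-+n (t + n∸k))))
      (tile-mod (t + n) t (mod-+n t))

    -- The offset of position p in its tile; k ∸ i₀ stands for - i₀ modulo k.
    offset : ℕ → ℕ
    offset p = (p + (k ∸ i₀)) % k

    offset≤p+n : ∀ p → offset p ≤ p + n
    offset≤p+n p = ≤-trans (<⇒≤ (<-trans (m%n<n (p + (k ∸ i₀)) k) k<n)) (m≤n+m n p)

    -- Assembles the differences of all tiles: `p` lies in the tile that starts at `p - offset p`,
    -- and the added `n` keeps the subtraction exact.
    mask : ℕ → Bool
    mask p = bit (difference (p + n ∸ offset p)) (offset p)

    mask-periodic : Periodic n mask
    mask-periodic p = trans (cong (λ l → bit (difference (p + n + n ∸ l)) l) offset-periodic)
      (cong (λ x → bit x (offset p)) (trans (cong difference (+-∸-comm n (offset≤p+n p)))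
        (difference-periodic (p + n ∸ offset p))))
      where
      offset-periodic : offset (p + n) ≡ offset p
      offset-periodic = trans (cong (_% k) (trans (+-assoc p n (k ∸ i₀)) (trans (cong (p +_) (+-comm n (k ∸ i₀)))
        (trans (sym (+-assoc p (k ∸ i₀) n)) (cong (p + (k ∸ i₀) +_) n≡m*k)))))
        ([m+kn]%n≡m%n (p + (k ∸ i₀)) m k)

    -- Adding `k ∸ i₀` completes `i = i₀ + i / k * k` to a multiple of `k`, which leaves `l`.
    offset-tile : ∀ i l → i % k ≡ i₀ → l < k → offset (i + l) ≡ l
    offset-tile i l e l<k = trans (cong (_% k) eq)
      (trans ([m+kn]%n≡m%n l (suc (i / k)) k) (m<n⇒m%n≡m l<k))
      where
      open ≡-Reasoning
      eq : i + l + (k ∸ i₀) ≡ l + suc (i / k) * k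
      eq = begin
        i + l + (k ∸ i₀)               ≡⟨ cong (_+ (k ∸ i₀)) (+-comm i l) ⟩
        l + i + (k ∸ i₀)               ≡⟨ +-assoc l i (k ∸ i₀) ⟩
        l + (i + (k ∸ i₀))             ≡⟨ cong (λ j → l + (j + (k ∸ i₀))) (m≡m%n+[m/n]*n i k) ⟩
        l + (i % k + i / k * k + (k ∸ i₀)) ≡⟨ cong (λ j → l + (j + i / k * k + (k ∸ i₀))) e ⟩
        l + (i₀ + i / k * k + (k ∸ i₀)) ≡⟨ cong (l +_) (+-assoc i₀ (i / k * k) (k ∸ i₀)) ⟩
        l + (i₀ + (i / k * k + (k ∸ i₀))) ≡⟨ cong (λ j → l + (i₀ + j)) (+-comm (i / k * k) (k ∸ i₀)) ⟩
        l + (i₀ + ((k ∸ i₀) + i / k * k)) ≡⟨ cong (l +_) (+-assoc i₀ (k ∸ i₀) (i / k * k)) ⟨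
        l + (i₀ + (k ∸ i₀) + i / k * k) ≡⟨ cong (λ j → l + (j + i / k * k)) (m+[n∸m]≡n (<⇒≤ (proj₁ (proj₂ first)))) ⟩
        l + suc (i / k) * k            ∎

    window-mask : ∀ i → 1 ≤ size i → window k mask i ≡ difference i
    window-mask i p = bit-ext _ _ λ l l<k → trans (bit-window k mask i l l<k)
      (trans (cong (λ o → bit (difference (i + l + n ∸ o)) o) (offset-tile i l (residue i p) l<k))
      (cong (λ x → bit x l) (trans (cong difference (start l)) (difference-periodic i))))
      where
      start : ∀ l → i + l + n ∸ l ≡ i + n
      start l = trans (cong (_∸ l) (trans (+-assoc i l n) (trans (cong (i +_) (+-comm l n)) (sym (+-assoc i n l)))))
        (m+n∸n≡m (i + n) l)

    φ : Automorphism n k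
    φ = flip-rotate-automorphism mask mask-periodic k n∸k k+[n∸k]≡n

    open Automorphism φ using (σ)

    size-k : ∀ t → 1 ≤ size t → 1 ≤ size (t + k)
    size-k t = subst (1 ≤_) (sym (size-k-periodic t))

    -- On this window the mask is `tile (toℕ i) ⊕ tile (toℕ i + k)`, and the first summand cancels.
    shifted-tile : ∀ (i : Fin n) → 1 ≤ size (toℕ i) → tile (toℕ i) ⊕ window k mask (toℕ ((toℕ i + k) mod n)) ≡ tile (toℕ i + k)
    shifted-tile i p = trans (cong (tile (toℕ i) ⊕_)
        (trans (window-mod mask mask-periodic (toℕ i + k)) (trans (window-mask (toℕ i + k) (size-k (toℕ i) p))
          (cong (_⊕ tile (toℕ i + k)) (tile-mod (toℕ i + k + n∸k) (toℕ i)
            (trans (cong (_mod n) (trans (+-assoc (toℕ i) k n∸k) (cong (toℕ i +_) k+[n∸k]≡n))) (mod-+n (toℕ i))))))))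
      (⊕-cancel (tile (toℕ i)) (tile (toℕ i + k)))

    size-mod : ∀ t → size (toℕ (t mod n)) ≡ size t
    size-mod t = trans (cong size (toℕ-mod t)) (periodic-% n size size-periodic t)

    preserves : ∀ v → c (σ v) ≡ c v
    preserves (i , x) = ≡-from-⇔ to from
      where
      w : Vec Bool k
      w = window k mask (toℕ ((toℕ i + k) mod n))
      to : c (i , x) ≡ b → c (σ (i , x)) ≡ b
      to e = trans (cong (λ y → c ((toℕ i + k) mod n , y)) (trans (cong (_⊕ w) (tile-unique e)) (shifted-tile i (size-≥1 e))))
        (tile-∈ (toℕ i + k) (size-k (toℕ i) (size-≥1 e)))
      from : c (σ (i , x)) ≡ b → c (i , x) ≡ b
      from e = trans (cong c (cong₂ _,_ (sym (mod-toℕ i)) x≡tile)) (tile-∈ (toℕ i) p)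
        where
        p : 1 ≤ size (toℕ i)
        -- The fibre of the image is occupied, so by `k`-periodicity fibre `i` is too.
        p = subst (1 ≤_) (trans (size-mod (toℕ i + k)) (size-k-periodic (toℕ i))) (size-≥1 e)
        x≡tile : x ≡ tile (toℕ i)
        x≡tile = trans (sym (⊕-involutive x w)) (trans (cong (_⊕ w)
          (trans (tile-unique e) (trans (tile-mod (toℕ ((toℕ i + k) mod n)) (toℕ i + k) (mod-toℕ ((toℕ i + k) mod n))) (sym (shifted-tile i p)))))
          (⊕-involutive (tile (toℕ i)) w))

    absurd : ⊥
    -- The symmetry sends fibre 0 to fibre `k`, which differs from it as `0 < k < n`.
    absurd = mod-shift-≢ k fzero z<s k<n (cong proj₁ (distinguishing φ preserves (fzero , replicate k false)))

  m+1≤classSize : m + 1 ≤ classSize n k c b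
  m+1≤classSize = subst (m + 1 ≤_) (sym (classSize-Σ N k c b))
    (subst (_≤ Σ< n size) (+-comm 1 m) (≰⇒> Tiling.absurd))

-- The upper bound: size of the coloured class

module UpperBound (N K : ℕ) (5≤n : 5 ≤ suc N) (0<K : 0 < K) (k<n : suc K < suc N)
                  (m : ℕ) (n≡m*k : suc N ≡ m * suc K) where

  open Colouring N K 5≤n 0<K k<n (divides m n≡m*k) public

  -- The zero strings and the marked vertex lie in different fibres because `k` does not divide 1,
  -- so no fibre holds two class vertices.
  size-colour : ∀ t → t < n → fibreSize N k colour true t ≡ indicator (does (k ∣? t)) + indicator (does (t ≟ 1))
  size-colour t t<n = go (k ∣? t) (t ≟ 1)
    where
    P : Vec Bool k → Bool
    P x = does (colour (t mod n , x) Bool.≟ true)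
    P⇒ : ∀ x → P x ≡ true → InC (t mod n , x)
    P⇒ x p = does-true (inC? (t mod n , x)) (does-true (_ Bool.≟ true) p)
    P⇐ : ∀ x → InC (t mod n , x) → P x ≡ true
    P⇐ x p = dec-true (_ Bool.≟ true) (dec-true (inC? (t mod n , x)) p)
    e : toℕ (t mod n) ≡ t
    e = toℕ-mod-< t<n
    go : (d : Dec (k ∣ t)) (d′ : Dec (t ≡ 1)) → count k P ≡ indicator (does d) + indicator (does d′)
    go (yes k∣t) (yes refl) = contradiction k∣t k∤1
    go (yes k∣t) (no t≢1)   = count-1 k P (replicate k false) (P⇐ _ (inj₁ (subst (k ∣_) (sym e) k∣t , refl)))
      λ w p → [ proj₂ , (λ q → contradiction (trans (sym e) (proj₁ q)) t≢1) ]′ (P⇒ w p)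
    go (no k∤t)  (yes t≡1)  = count-1 k P (true ∷ replicate K false) (P⇐ _ (inj₂ (trans e t≡1 , refl)))
      λ w p → [ (λ q → contradiction (subst (k ∣_) e (proj₁ q)) k∤t) , proj₂ ]′ (P⇒ w p)
    go (no k∤t)  (no t≢1)   = count-0 k P λ w p →
      [ (λ q → k∤t (subst (k ∣_) e (proj₁ q))) , (λ q → t≢1 (trans (sym e) (proj₁ q))) ]′ (P⇒ w p)

  Σ-at-1 : ∀ p → 2 ≤ p → Σ< p (λ t → indicator (does (t ≟ 1))) ≡ 1
  Σ-at-1 (suc (suc p)) _ = cong suc (Σ-zero p)
  Σ-at-1 (suc zero) (s≤s ())

  classSize-colour : classSize n k colour true ≡ m + 1
  classSize-colour = trans (classSize-Σ N k colour true)
    (trans (Σ-cong n size-colour)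
    (trans (Σ-+ n (indicator ∘ does ∘ (k ∣?_)) (λ t → indicator (does (t ≟ 1))))
    (cong₂ _+_ (trans (cong (λ p → Σ< p (indicator ∘ does ∘ (k ∣?_))) n≡m*k) (Σ-multiples K m))
      (Σ-at-1 n (≤-trans (n≤1+n 2) 3≤n)))))

theorem6p3 : (n k : ℕ) → .{{_ : NonZero k}} → 5 ≤ n → 2 ≤ k → k < n → k ∣ n →
    IsRho n k (n / k + 1)
theorem6p3 n@(suc N) k@(suc K) 5≤n 2≤k k<n (divides m n≡m*k) =
  subst (IsRho n k) (cong (_+ 1) (sym (trans (cong (_/ k) n≡m*k) (m*n/n≡m m k))))
    ( (U.colour , U.distinguishing , true , U.classSize-colour)
    , λ c d b → LowerBound.m+1≤classSize N K 5≤n (s≤s⁻¹ 2≤k) k<n m n≡m*k c d b )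
  where module U = UpperBound N K 5≤n (s≤s⁻¹ 2≤k) k<n m n≡m*k
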